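{- For all $k\in\mathbb{N}$ there exists an oriented graph $D$ with $\operatorname{inv}(D)=2\tau(D)=2k$.
   Context: All digraphs are oriented graphs: directed graphs without loops, digons or parallel edges. For a digraph $D$ and $X\subseteq V(D)$, inverting $X$ in $D$ means reversing the direction of every edge with both endpoints in $X$. A family $X_1,\dots,X_k\subseteq V(D)$ is a decycling family of $D$ if inverting $X_1,\dots,X_k$ in turn yields an acyclic digraph; $\operatorname{inv}(D)$ is the minimum size of a decycling family. A cycle transversal of $D$ is a set of vertices whose removal leaves an acyclic digraph, and $\tau(D)$ is the minimum size of a cycle transversal of $D$. -}

module Defs where

open import Data.Nat using (ℕ; _≤_)
open import Data.Bool using (Bool; true; false; _∧_; not; if_then_else_)
open import Data.Fin using (Fin)
open import Data.Fin.Subset using (Subset; ∣_∣)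
open import Data.Vec using (lookup)
open import Data.List using (List; length; foldl)
open import Data.Product using (Σ; _×_)
open import Relation.Binary.PropositionalEquality using (_≡_)
open import Relation.Binary.Construct.Closure.Transitive using (TransClosure)
open import Relation.Nullary using (¬_)

Adj : ℕ → Set
Adj n = Fin n → Fin n → Bool

-- Oriented graph: no loops, no digons (parallel edges impossible by
-- construction of an adjacency relation).
record Oriented (n : ℕ) : Set where
  field
    adj      : Adj n
    loopless : ∀ u → adj u u ≡ false
    noDigon  : ∀ u v → adj u v ≡ true → adj v u ≡ false
open Oriented public

mem : ∀ {n} → Fin n → Subset n → Bool
mem u X = lookup X u

Edge : ∀ {n} → Adj n → Fin n → Fin n → Set
Edge a u v = a u v ≡ true

-- Acyclic: no directed closed walk of positive length (equivalently, no
-- directed cycle).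
Acyclic : ∀ {n} → Adj n → Set
Acyclic a = ∀ u → ¬ TransClosure (Edge a) u u

invert : ∀ {n} → Adj n → Subset n → Adj n
invert a X u v = if mem u X ∧ mem v X then a v u else a u v

invertAll : ∀ {n} → Adj n → List (Subset n) → Adj n
invertAll a Xs = foldl invert a Xs

Decycling : ∀ {n} → Oriented n → List (Subset n) → Set
Decycling D Xs = Acyclic (invertAll (adj D) Xs)

InvIs : ∀ {n} → Oriented n → ℕ → Set
InvIs D m =
  Σ (List _) (λ Xs → Decycling D Xs × length Xs ≡ m)
  × (∀ Xs → Decycling D Xs → m ≤ length Xs)

-- Deleting the vertices of S (they become isolated, which does not
-- affect acyclicity).
delete : ∀ {n} → Adj n → Subset n → Adj n
delete a S u v = a u v ∧ not (mem u S) ∧ not (mem v S)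

CycleTransversal : ∀ {n} → Oriented n → Subset n → Set
CycleTransversal D S = Acyclic (delete (adj D) S)

TauIs : ∀ {n} → Oriented n → ℕ → Set
TauIs D m =
  Σ (Subset _) (λ S → CycleTransversal D S × ∣ S ∣ ≡ m)
  × (∀ S → CycleTransversal D S → m ≤ ∣ S ∣)

{-# OPTIONS --safe #-}
module Submission where

-- Take pivots v 0 , … , v (k − 1) and a long sequence of blocks, each with k + 1
-- vertices of types 0 , … , k. Arcs go from earlier to later blocks, v i points
-- to all vertices of type i + 1, and all other vertices outside the pivots point to
-- v i. Making each pivot a sink costs two inversions.
--
-- Conversely, m inversions give each vertex a membership vector in F₂^m, and an
-- arc is reversed iff the vectors of its ends have inner product 1. By
-- pigeonhole three blocks carry the same vectors z 0 , … , z k. If the result is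
-- acyclic, triangles force all z j · z j′ to agree and, writing y i for the
-- vector of v i, y i · z j + [j = i + 1] not to depend on j. Hence the differences
-- z j − z 0 span a totally isotropic space on which the y i form a dual basis,
-- and such a configuration needs dimension 2k.

open import Defs
open import Algebra.Bundles using (CommutativeRing)
open import Data.Bool using (Bool; true; false; T; _∧_; _xor_; not; if_then_else_)
open import Data.Bool.Properties
  using (xor-∧-commutativeRing; xor-same; xor-assoc; xor-comm; xor-identityʳ;
         ∧-comm; ∧-assoc; ∧-zeroʳ; ∧-identityʳ; ∧-distribʳ-xor)
open import Data.Empty using (⊥; ⊥-elim)
open import Data.Fin
  using (Fin; zero; suc; toℕ; splitAt; join; combine; remQuot; finToFun; funToFin; inject≤)
  renaming (_<_ to _<ᶠ_)
open import Data.Fin.Properties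
  using (_≟_; toℕ<n; toℕ-inject≤; toℕ-injective; suc-injective; splitAt-join; remQuot-combine; combine-remQuot;
         toℕ-combine; combine-monoˡ-<; funToFin-finToFin; finToFun-funToFin; injective⇒≤; pigeonhole; 2↔Bool)
open import Data.Fin.Subset using (Subset; ∣_∣; _∈_; _-_; ⊤) renaming (⊥ to ∅)
open import Data.Fin.Subset.Properties using (x∈p⇒∣p-x∣<∣p∣; x∈p∧x≢y⇒x∈p-y; ∣⊤∣≡n; ∣⊥∣≡0)
open import Data.List as List using (List; []; _∷_; _++_; length)
open import Data.List.Properties using (length-++; length-tabulate)
open import Data.Nat as ℕ using (ℕ; zero; suc; _+_; _*_; _^_; _≤_; _<_; _<?_; pred; z≤n; s≤s)
open import Data.Nat.Properties as ℕₚ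
  using (<-irrefl; <-trans; ≤-trans; _≤?_; ≰⇒>; <⇒≤; <⇒≱)
open import Data.Product using (Σ; ∃; _×_; _,_; proj₁; proj₂; uncurry)
open import Data.Sum using (_⊎_; inj₁; inj₂; map₂)
open import Data.Unit using (tt)
open import Data.Vec as Vec using (lookup; tabulate)
open import Data.Vec.Properties using (lookup∘tabulate; lookup-splitAt; lookup-replicate; lookup⇒[]=)
open import Function using (_∘_; Inverse)
open import Relation.Binary.Construct.Closure.Transitive using (TransClosure; [_]; _∷_)
open import Relation.Binary.PropositionalEquality
open import Relation.Nullary using (yes; no; does; contradiction)
open import Relation.Nullary.Decidable using (dec-true; dec-false)

open CommutativeRing xor-∧-commutativeRing using (semiring)
open import Algebra.Properties.Semiring.Sum semiring
  using (sum; sum-cong-≗; ∑-distrib-+; ∑-comm; *-distribʳ-sum; *-distribˡ-sum; sum-replicate-zero)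

-- Linear algebra over the field with two elements

xor-cancelˡ : ∀ p {q r} → p xor q ≡ p xor r → q ≡ r
xor-cancelˡ false eq = eq
xor-cancelˡ true {false} {false} eq = refl
xor-cancelˡ true {true} {true} eq = refl

sum-select : ∀ {n} (f : Fin n → Bool) j → sum (λ i → f i ∧ does (i ≟ j)) ≡ f j
sum-select {suc n} f zero = begin
  (f zero ∧ true) xor sum (λ i → f (suc i) ∧ false)
    ≡⟨ cong₂ _xor_ (∧-identityʳ (f zero)) (sum-cong-≗ (λ i → ∧-zeroʳ (f (suc i)))) ⟩
  f zero xor sum {n} (λ _ → false)
    ≡⟨ cong (f zero xor_) (sum-replicate-zero n) ⟩
  f zero xor false
    ≡⟨ xor-identityʳ (f zero) ⟩
  f zero ∎
  where open ≡-Reasoning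
sum-select {suc n} f (suc j) =
  cong₂ _xor_ (∧-zeroʳ (f zero)) (sum-select (f ∘ suc) j)

Vector₂ : ℕ → Set
Vector₂ m = Fin m → Bool

infixl 7 _·_
_·_ : ∀ {m} → Vector₂ m → Vector₂ m → Bool
x · y = sum (λ r → x r ∧ y r)

infixl 6 _⊕_
_⊕_ : ∀ {m} → Vector₂ m → Vector₂ m → Vector₂ m
(x ⊕ y) r = x r xor y r

combination : ∀ {m k} → Vector₂ k → (Fin k → Vector₂ m) → Vector₂ m
combination a w r = sum (λ i → a i ∧ w i r)

·-cong : ∀ {m} {x x′ y y′ : Vector₂ m} → x ≗ x′ → y ≗ y′ → x · y ≡ x′ · y′
·-cong p q = sum-cong-≗ (λ r → cong₂ _∧_ (p r) (q r))

·-comm : ∀ {m} (x y : Vector₂ m) → x · y ≡ y · x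
·-comm x y = sum-cong-≗ (λ r → ∧-comm (x r) (y r))

⊕-· : ∀ {m} (x y u : Vector₂ m) → (x ⊕ y) · u ≡ x · u xor y · u
⊕-· x y u = trans (sum-cong-≗ (λ r → ∧-distribʳ-xor (u r) (x r) (y r)))
                  (∑-distrib-+ (λ r → x r ∧ u r) (λ r → y r ∧ u r))

·-⊕ : ∀ {m} (u x y : Vector₂ m) → u · (x ⊕ y) ≡ u · x xor u · y
·-⊕ u x y = trans (·-comm u (x ⊕ y)) (trans (⊕-· x y u) (cong₂ _xor_ (·-comm x u) (·-comm y u)))

combination-· : ∀ {m k} (a : Vector₂ k) (w : Fin k → Vector₂ m) u →
                combination a w · u ≡ sum (λ i → a i ∧ w i · u)
combination-· a w u = begin
  sum (λ r → sum (λ i → a i ∧ w i r) ∧ u r)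
    ≡⟨ sum-cong-≗ (λ r → *-distribʳ-sum (u r) (λ i → a i ∧ w i r)) ⟩
  sum (λ r → sum (λ i → (a i ∧ w i r) ∧ u r))
    ≡⟨ ∑-comm (λ r i → (a i ∧ w i r) ∧ u r) ⟩
  sum (λ i → sum (λ r → (a i ∧ w i r) ∧ u r))
    ≡⟨ sum-cong-≗ (λ i → trans (sum-cong-≗ (λ r → ∧-assoc (a i) (w i r) (u r)))
                               (sym (*-distribˡ-sum (a i) (λ r → w i r ∧ u r)))) ⟩
  sum (λ i → a i ∧ w i · u) ∎
  where open ≡-Reasoning

-- Vectors are functions and are compared pointwise; passing to numbers turns this into
-- propositional equality, so that counting and the pigeonhole principle in `Fin` apply.
code : ∀ {m} → Vector₂ m → Fin (2 ^ m)
code x = funToFin (Inverse.from 2↔Bool ∘ x)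

bits : ∀ {m} → Fin (2 ^ m) → Vector₂ m
bits {m} s r = Inverse.to 2↔Bool (finToFun {2} {m} s r)

code-injective : ∀ {m} (x y : Vector₂ m) → code x ≡ code y → x ≗ y
code-injective x y eq r = begin
  x r                                        ≡⟨ bits-code x r ⟨
  bits (code x) r                            ≡⟨ cong (λ s → bits s r) eq ⟩
  bits (code y) r                            ≡⟨ bits-code y r ⟩
  y r                                        ∎
  where
  open ≡-Reasoning
  bits-code : ∀ x → bits (code x) ≗ x
  bits-code x r = trans (cong (Inverse.to 2↔Bool) (finToFun-funToFin (Inverse.from 2↔Bool ∘ x) r))
                        (Inverse.strictlyInverseˡ 2↔Bool (x r))

funToFin-cong : ∀ {m n} {f g : Fin m → Fin n} → f ≗ g → funToFin f ≡ funToFin g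
funToFin-cong {zero}  p = refl
funToFin-cong {suc m} p = cong₂ combine (p zero) (funToFin-cong (p ∘ suc))

bits-injective : ∀ {m} (s t : Fin (2 ^ m)) → bits {m} s ≗ bits t → s ≡ t
bits-injective {m} s t eq =
  trans (sym (code-bits s)) (trans (funToFin-cong (cong (Inverse.from 2↔Bool) ∘ eq)) (code-bits t))
  where
  code-bits : ∀ s → code (bits {m} s) ≡ s
  code-bits s = trans (funToFin-cong (λ r → Inverse.strictlyInverseʳ 2↔Bool (finToFun {2} {m} s r)))
                      (funToFin-finToFin {m} {2} s)

-- Pairing a combination of the y i and d i with the d j recovers the
-- coefficients of the y i, and then pairing with the y j those of the d i, so
-- the 2k vectors span a space of 2 ^ 2k elements.
isotropic-dimension : ∀ {k m} (y d : Fin k → Vector₂ m) →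
                      (∀ i j → d i · d j ≡ false) → (∀ i j → y i · d j ≡ does (i ≟ j)) →
                      2 * k ≤ m
isotropic-dimension {k} {m} y d isotropic dual with 2 * k ≤? m
... | yes 2k≤m = 2k≤m
... | no  2k≰m = contradiction 2^2k≤2^m (<⇒≱ (ℕₚ.^-monoʳ-< 2 (s≤s (s≤s z≤n)) (≰⇒> 2k≰m)))
  where
  open ≡-Reasoning

  vec : Vector₂ k → Vector₂ k → Vector₂ m
  vec a b = combination a y ⊕ combination b d

  vec-·d : ∀ a b j → vec a b · d j ≡ a j
  vec-·d a b j = begin
    vec a b · d j
      ≡⟨ ⊕-· (combination a y) (combination b d) (d j) ⟩
    combination a y · d j xor combination b d · d j
      ≡⟨ cong₂ _xor_ (combination-· a y (d j)) (combination-· b d (d j)) ⟩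
    sum (λ i → a i ∧ y i · d j) xor sum (λ i → b i ∧ d i · d j)
      ≡⟨ cong₂ _xor_ (sum-cong-≗ (λ i → cong (a i ∧_) (dual i j)))
                     (sum-cong-≗ (λ i → trans (cong (b i ∧_) (isotropic i j)) (∧-zeroʳ (b i)))) ⟩
    sum (λ i → a i ∧ does (i ≟ j)) xor sum {k} (λ i → false)
      ≡⟨ cong₂ _xor_ (sum-select a j) (sum-replicate-zero k) ⟩
    a j xor false
      ≡⟨ xor-identityʳ (a j) ⟩
    a j ∎

  vec-·y : ∀ a b j → vec a b · y j ≡ sum (λ i → a i ∧ y i · y j) xor b j
  vec-·y a b j = begin
    vec a b · y j
      ≡⟨ ⊕-· (combination a y) (combination b d) (y j) ⟩
    combination a y · y j xor combination b d · y j
      ≡⟨ cong₂ _xor_ (combination-· a y (y j)) (combination-· b d (y j)) ⟩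
    sum (λ i → a i ∧ y i · y j) xor sum (λ i → b i ∧ d i · y j)
      ≡⟨ cong (sum (λ i → a i ∧ y i · y j) xor_)
              (trans (sum-cong-≗ (λ i → cong (b i ∧_) (trans (·-comm (d i) (y j)) (trans (dual j i) (≟-sym j i)))))
                     (sum-select b j)) ⟩
    sum (λ i → a i ∧ y i · y j) xor b j ∎
    where
    ≟-sym : ∀ {n} (i j : Fin n) → does (i ≟ j) ≡ does (j ≟ i)
    ≟-sym i j with i ≟ j
    ... | yes i≡j = sym (dec-true (j ≟ i) (sym i≡j))
    ... | no  i≢j = sym (dec-false (j ≟ i) (i≢j ∘ sym))

  vec-injective : ∀ a b a′ b′ → vec a b ≗ vec a′ b′ → a ≗ a′ × b ≗ b′
  vec-injective a b a′ b′ eq = a≗a′ , b≗b′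
    where
    a≗a′ : a ≗ a′
    a≗a′ j = trans (sym (vec-·d a b j)) (trans (·-cong {y = d j} eq (λ _ → refl)) (vec-·d a′ b′ j))

    b≗b′ : b ≗ b′
    -- Nothing is known about the products `y i · y j`, but their sum depends only on the
    -- coefficients `a`, which are already recovered, so it cancels.
    b≗b′ j = xor-cancelˡ (sum (λ i → a i ∧ y i · y j)) (begin
      sum (λ i → a i ∧ y i · y j) xor b j    ≡⟨ vec-·y a b j ⟨
      vec a b · y j                          ≡⟨ ·-cong {y = y j} eq (λ _ → refl) ⟩
      vec a′ b′ · y j                        ≡⟨ vec-·y a′ b′ j ⟩
      sum (λ i → a′ i ∧ y i · y j) xor b′ j
        ≡⟨ cong (_xor b′ j) (sum-cong-≗ (λ i → cong (_∧ y i · y j) (a≗a′ i))) ⟨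
      sum (λ i → a i ∧ y i · y j) xor b′ j   ∎)

  vecs : Fin (2 ^ k) × Fin (2 ^ k) → Fin (2 ^ m)
  vecs (s , t) = code (vec (bits {k} s) (bits {k} t))

  vecs-injective : ∀ p q → vecs p ≡ vecs q → p ≡ q
  vecs-injective (s , t) (s′ , t′) eq
    with a≗ , b≗ ← vec-injective _ _ _ _ (code-injective (vec (bits s) (bits t)) (vec (bits s′) (bits t′)) eq)
    = cong₂ _,_ (bits-injective {k} s s′ a≗) (bits-injective {k} t t′ b≗)

  2^2k≤2^m : 2 ^ (2 * k) ≤ 2 ^ m
  2^2k≤2^m = subst (_≤ 2 ^ m)
    (trans (sym (ℕₚ.^-distribˡ-+-* 2 k k)) (cong (λ l → 2 ^ (k + l)) (sym (ℕₚ.+-identityʳ k))))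
    (injective⇒≤ {f = vecs ∘ remQuot (2 ^ k)} (λ {s} {t} eq →
      trans (sym (combine-remQuot {2 ^ k} (2 ^ k) s))
        (trans (cong (uncurry combine) (vecs-injective _ _ eq)) (combine-remQuot {2 ^ k} (2 ^ k) t))))

-- Finite combinatorics

combine-monoʳ-< : ∀ {m n} (a : Fin m) {i j : Fin n} → i <ᶠ j → combine a i <ᶠ combine a j
combine-monoʳ-< {n = n} a {i} {j} i<j =
  subst₂ _<_ (sym (toℕ-combine a i)) (sym (toℕ-combine a j)) (ℕₚ.+-monoʳ-< (n * toℕ a) i<j)

-- Cut the `g * g` indices into `g` consecutive groups of `g`. Each group repeats some value, and
-- two groups repeat the same one; take both indices from the earlier group and one from the later.
pigeonhole₃ : ∀ {q g} → q < g → (f : Fin (g * g) → Fin q) →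
              ∃ λ x → ∃ λ y → ∃ λ z → x <ᶠ y × y <ᶠ z × f x ≡ f y × f x ≡ f z
pigeonhole₃ {q} {g} q<g f =
  let pair a = pigeonhole q<g (λ i → f (combine a i))
      a , a′ , a<a′ , eq′ = pigeonhole q<g (λ a → f (combine a (proj₁ (pair a))))
      i , j , i<j , eq = pair a
      i′ = proj₁ (pair a′)
  in combine a i , combine a j , combine a′ i′ ,
     combine-monoʳ-< a i<j , combine-monoˡ-< j i′ a<a′ , eq , eq′

injection⇒≤∣S∣ : ∀ {k n} (S : Subset n) (f : Fin k → Fin n) →
                 (∀ i → f i ∈ S) → (∀ i j → f i ≡ f j → i ≡ j) → k ≤ ∣ S ∣
injection⇒≤∣S∣ {zero}  S f f∈S inj = z≤n
injection⇒≤∣S∣ {suc k} S f f∈S inj =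
  ≤-trans (s≤s (injection⇒≤∣S∣ (S - f zero) (f ∘ suc)
                  (λ i → x∈p∧x≢y⇒x∈p-y (f∈S (suc i)) (λ eq → contradiction (inj (suc i) zero eq) λ ()))
                  (λ i j eq → suc-injective (inj _ _ eq))))
          (x∈p⇒∣p-x∣<∣p∣ (f∈S zero))

∣++∣ : ∀ {m n} (p : Subset m) (q : Subset n) → ∣ p Vec.++ q ∣ ≡ ∣ p ∣ + ∣ q ∣
∣++∣ Vec.[]            q = refl
∣++∣ (true  Vec.∷ p) q = cong suc (∣++∣ p q)
∣++∣ (false Vec.∷ p) q = ∣++∣ p q

-- Digraphs and inversions

increasing⇒acyclic : ∀ {n} (a : Adj n) (rank : Fin n → ℕ) →
                     (∀ u v → Edge a u v → rank u < rank v) → Acyclic a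
increasing⇒acyclic a rank incr u cycle = <-irrefl refl (walk cycle)
  where
  walk : ∀ {u v} → TransClosure (Edge a) u v → rank u < rank v
  walk [ e ]    = incr _ _ e
  walk (e ∷ es) = <-trans (incr _ _ e) (walk es)

membership : ∀ {n} (Xs : List (Subset n)) → Fin n → Vector₂ (length Xs)
membership Xs u r = mem u (List.lookup Xs r)

flips : ∀ {n} → List (Subset n) → Fin n → Fin n → Bool
flips Xs u v = membership Xs u · membership Xs v

-- Two reversals of an arc cancel, so only the parity of the number of sets containing both ends
-- matters. This turns inversions into inner products.
invertAll-flips : ∀ {n} (Xs : List (Subset n)) (a : Adj n) u v →
                  invertAll a Xs u v ≡ (if flips Xs u v then a v u else a u v)
invertAll-flips []       a u v = refl
invertAll-flips (X ∷ Xs) a u v =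
  trans (invertAll-flips Xs (invert a X) u v)
        (merge (mem u X) (mem v X) (flips Xs u v))
  where
  merge : ∀ p q s {x y : Bool} →
          -- The conjunction is `q ∧ p` in the first branch because a flip by the later sets looks
          -- the pair up in the order `v`, `u`.
          (if s then (if q ∧ p then x else y) else (if p ∧ q then y else x))
          ≡ (if (p ∧ q) xor s then y else x)
  merge false false false = refl
  merge false false true  = refl
  merge false true  false = refl
  merge false true  true  = refl
  merge true  false false = refl
  merge true  false true  = refl
  merge true  true  false = refl
  merge true  true  true  = refl

flips-tabulate : ∀ {n k} (A : Fin k → Subset n) u v →
                 flips (List.tabulate A) u v ≡ sum (λ i → mem u (A i) ∧ mem v (A i))
flips-tabulate {k = zero}  A u v = refl
flips-tabulate {k = suc k} A u v = cong ((mem u (A zero) ∧ mem v (A zero)) xor_) (flips-tabulate (A ∘ suc) u v)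

flips-++ : ∀ {n} (Xs Ys : List (Subset n)) u v → flips (Xs ++ Ys) u v ≡ flips Xs u v xor flips Ys u v
flips-++ []       Ys u v = refl
flips-++ (X ∷ Xs) Ys u v =
  trans (cong ((mem u X ∧ mem v X) xor_) (flips-++ Xs Ys u v))
        (sym (xor-assoc (mem u X ∧ mem v X) (flips Xs u v) (flips Ys u v)))

-- The extremal oriented graph

module Construction (k B : ℕ) where

  Vertex : Set
  Vertex = Fin k ⊎ (Fin B × Fin (suc k))

  size : ℕ
  size = k + B * suc k

  encode : Vertex → Fin size
  encode = join k (B * suc k) ∘ map₂ (uncurry combine)

  decode : Fin size → Vertex
  decode = map₂ (remQuot (suc k)) ∘ splitAt k

  decode-encode : ∀ a → decode (encode a) ≡ a
  decode-encode (inj₁ i) = cong (map₂ (remQuot (suc k))) (splitAt-join k (B * suc k) (inj₁ i))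
  decode-encode (inj₂ (b , j)) =
    trans (cong (map₂ (remQuot (suc k))) (splitAt-join k (B * suc k) (inj₂ (combine b j))))
          (cong inj₂ (remQuot-combine b j))

  -- No pivot points to type `zero`: its vector serves as the origin from which the differences `d`
  -- are taken.
  isSuc : Fin k → Fin (suc k) → Bool
  isSuc i zero    = false
  isSuc i (suc j) = does (i ≟ j)

  arc : Vertex → Vertex → Bool
  arc (inj₁ _)       (inj₁ _)        = false
  arc (inj₁ i)       (inj₂ (_ , j))  = isSuc i j
  arc (inj₂ (_ , j)) (inj₁ i)        = not (isSuc i j)
  arc (inj₂ (b , _)) (inj₂ (b′ , _)) = does (toℕ b <? toℕ b′)

  arc⇒< : ∀ (b b′ : Fin B) → does (toℕ b <? toℕ b′) ≡ true → b <ᶠ b′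
  arc⇒< b b′ eq = ℕₚ.<ᵇ⇒< (toℕ b) (toℕ b′) (subst T (sym eq) tt)

  arc-irreflexive : ∀ a → arc a a ≡ false
  arc-irreflexive (inj₁ i)       = refl
  arc-irreflexive (inj₂ (b , _)) = dec-false (toℕ b <? toℕ b) (<-irrefl refl)

  arc-asymmetric : ∀ a a′ → arc a a′ ≡ true → arc a′ a ≡ false
  arc-asymmetric (inj₁ i) (inj₂ (_ , j)) eq = cong not eq
  arc-asymmetric (inj₂ (_ , j)) (inj₁ i) eq with isSuc i j
  ... | false = refl
  arc-asymmetric (inj₂ (b , _)) (inj₂ (b′ , _)) eq =
    dec-false (toℕ b′ <? toℕ b) (λ b′<b → <-irrefl refl (<-trans b′<b (arc⇒< b b′ eq)))

  graph : Oriented size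
  graph .adj u v     = arc (decode u) (decode v)
  graph .loopless u  = arc-irreflexive (decode u)
  graph .noDigon u v = arc-asymmetric (decode u) (decode v)

  -- One rank for two acyclicity proofs: deleting `pivots` leaves only arcs between blocks, and
  -- inverting `family` makes the pivots sinks, hence their value `B` above all blocks.
  rank : Vertex → ℕ
  rank (inj₁ _)       = B
  rank (inj₂ (b , _)) = toℕ b

  adj-encode : ∀ a a′ → adj graph (encode a) (encode a′) ≡ arc a a′
  adj-encode a a′ = cong₂ arc (decode-encode a) (decode-encode a′)

  -- The cycle transversal number

  pivots : Subset size
  pivots = ⊤ {k} Vec.++ ∅ {B * suc k}

  isPivot : Vertex → Bool
  isPivot (inj₁ _) = true
  isPivot (inj₂ _) = false

  mem-pivots : ∀ u → mem u pivots ≡ isPivot (decode u)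
  mem-pivots u rewrite lookup-splitAt k (⊤ {k}) (∅ {B * suc k}) u with splitAt k u
  ... | inj₁ i = lookup-replicate i true
  ... | inj₂ t = lookup-replicate t false

  pivots-transversal : CycleTransversal graph pivots
  pivots-transversal = increasing⇒acyclic _ (rank ∘ decode) λ u v e →
    increasing (decode u) (decode v)
      (trans (cong₂ (λ p q → adj graph u v ∧ not p ∧ not q) (sym (mem-pivots u)) (sym (mem-pivots v))) e)
    where
    increasing : ∀ a a′ → arc a a′ ∧ not (isPivot a) ∧ not (isPivot a′) ≡ true → rank a < rank a′
    increasing (inj₁ i) (inj₂ (_ , j)) e = contradiction (trans (sym (∧-zeroʳ (isSuc i j))) e) λ ()
    increasing (inj₂ (_ , j)) (inj₁ i) e = contradiction (trans (sym (∧-zeroʳ (not (isSuc i j)))) e) λ ()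
    increasing (inj₂ (b , _)) (inj₂ (b′ , _)) e = arc⇒< b b′ (trans (sym (∧-identityʳ _)) e)

  ∣pivots∣≡k : ∣ pivots ∣ ≡ k
  ∣pivots∣≡k = begin
    ∣ pivots ∣                       ≡⟨ ∣++∣ (⊤ {k}) (∅ {B * suc k}) ⟩
    ∣ ⊤ {k} ∣ + ∣ ∅ {B * suc k} ∣    ≡⟨ cong₂ _+_ (∣⊤∣≡n k) (∣⊥∣≡0 (B * suc k)) ⟩
    k + 0                            ≡⟨ ℕₚ.+-identityʳ k ⟩
    k                                ∎
    where open ≡-Reasoning

  -- The triangles v i → (0 , i + 1) → (i + 1 , 0) → v i are pairwise disjoint.
  transversal⇒k≤ : k < B → ∀ S → CycleTransversal graph S → k ≤ ∣ S ∣
  transversal⇒k≤ k<B S acyclic =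
    injection⇒≤∣S∣ S (λ i → proj₁ (hit i)) (λ i → lookup⇒[]= _ S (proj₁ (proj₂ (hit i))))
      (λ i j eq → toℕ-injective (trans (sym (proj₂ (proj₂ (hit i))))
                                (trans (cong (label ∘ decode) eq) (proj₂ (proj₂ (hit j))))))
    where
    block : Fin (suc k) → Fin B
    block = λ i → inject≤ i k<B

    -- All three vertices of the triangle through `v i` have label `i`, with `pred` undoing the
    -- shift in the block number `i + 1`. Hence the vertices hit for different `i` are distinct.
    label : Vertex → ℕ
    label (inj₁ i)           = toℕ i
    label (inj₂ (b , zero))  = pred (toℕ b)
    label (inj₂ (_ , suc i)) = toℕ i

    surviving : ∀ a a′ → mem (encode a) S ≡ false → mem (encode a′) S ≡ false → arc a a′ ≡ true →
                Edge (delete (adj graph) S) (encode a) (encode a′)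
    surviving a a′ p q e rewrite adj-encode a a′ | p | q | e = refl

    hit : ∀ i → ∃ λ u → mem u S ≡ true × label (decode u) ≡ toℕ i
    hit i with mem (encode (inj₁ i)) S in p
             | mem (encode (inj₂ (block zero , suc i))) S in q
             | mem (encode (inj₂ (block (suc i) , zero))) S in r
    ... | true  | _     | _     = _ , p , cong label (decode-encode (inj₁ i))
    ... | false | true  | _     = _ , q , cong label (decode-encode (inj₂ (block zero , suc i)))
    ... | false | false | true  = _ , r , trans (cong label (decode-encode (inj₂ (block (suc i) , zero))))
                                                (cong pred (toℕ-inject≤ (suc i) k<B))
    ... | false | false | false = ⊥-elim (acyclic _
      ( surviving (inj₁ i) (inj₂ (block zero , suc i)) p q (dec-true (i ≟ i) refl)
      ∷ surviving (inj₂ (block zero , suc i)) (inj₂ (block (suc i) , zero)) q r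
          (dec-true (toℕ (block zero) <? toℕ (block (suc i)))
            (subst₂ _<_ (sym (toℕ-inject≤ zero k<B)) (sym (toℕ-inject≤ (suc i) k<B)) (s≤s z≤n)))
      ∷ [ surviving (inj₂ (block (suc i) , zero)) (inj₁ i) r p refl ]))

  τ-graph : k < B → TauIs graph k
  τ-graph k<B = (pivots , pivots-transversal , ∣pivots∣≡k) , transversal⇒k≤ k<B

  -- A decycling family with 2k sets

  fromPredicate : (Vertex → Bool) → Subset size
  fromPredicate P = tabulate (P ∘ decode)

  outNeighbour closedOutNeighbour : Fin k → Vertex → Bool
  outNeighbour i (inj₁ _)             = false
  outNeighbour i (inj₂ (_ , j))       = isSuc i j
  closedOutNeighbour i (inj₁ i′)      = does (i ≟ i′)
  closedOutNeighbour i (inj₂ (_ , j)) = isSuc i j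

  -- Inverting the closed and then the open out-neighbourhood of v i turns v i
  -- into a sink and changes no other arc.
  family : List (Subset size)
  family = List.tabulate (fromPredicate ∘ closedOutNeighbour)
        ++ List.tabulate (fromPredicate ∘ outNeighbour)

  flips-fromPredicate : ∀ (P : Fin k → Vertex → Bool) u v →
    flips (List.tabulate (fromPredicate ∘ P)) u v ≡ sum (λ i → P i (decode u) ∧ P i (decode v))
  flips-fromPredicate P u v = trans (flips-tabulate (fromPredicate ∘ P) u v)
    (sum-cong-≗ (λ i → cong₂ _∧_ (lookup∘tabulate (P i ∘ decode) u) (lookup∘tabulate (P i ∘ decode) v)))

  flips-family : ∀ u v → flips family u v ≡
    sum (λ i → closedOutNeighbour i (decode u) ∧ closedOutNeighbour i (decode v))
    xor sum (λ i → outNeighbour i (decode u) ∧ outNeighbour i (decode v))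
  flips-family u v =
    trans (flips-++ (List.tabulate (fromPredicate ∘ closedOutNeighbour))
                    (List.tabulate (fromPredicate ∘ outNeighbour)) u v)
          (cong₂ _xor_ (flips-fromPredicate closedOutNeighbour u v) (flips-fromPredicate outNeighbour u v))

  family-decycling : Decycling graph family
  family-decycling = increasing⇒acyclic _ (rank ∘ decode) λ u v e →
    increasing (decode u) (decode v)
      (trans (sym (trans (invertAll-flips family (adj graph) u v)
                         (cong (λ s → if s then adj graph v u else adj graph u v) (flips-family u v)))) e)
    where
    increasing : ∀ a a′ →
      (if sum (λ i → closedOutNeighbour i a ∧ closedOutNeighbour i a′)
          xor sum (λ i → outNeighbour i a ∧ outNeighbour i a′)
       then arc a′ a else arc a a′) ≡ true →
      rank a < rank a′
    increasing (inj₁ i) (inj₁ i′) e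
      with sum (λ h → does (h ≟ i) ∧ does (h ≟ i′)) xor sum {k} (λ _ → false)
    increasing (inj₁ i) (inj₁ i′) () | true
    increasing (inj₁ i) (inj₁ i′) () | false
    increasing (inj₁ i) (inj₂ (_ , j)) e
      -- Only the closed out-neighbourhood of `v i` contains `v i`, and no open one contains a
      -- pivot. The parity is therefore `isSuc i j`: exactly the arcs leaving `v i` are reversed.
      rewrite sum-cong-≗ (λ h → ∧-comm (does (h ≟ i)) (isSuc h j))
            | sum-select (λ h → isSuc h j) i
            | sum-replicate-zero k
      with isSuc i j
    increasing (inj₁ i) (inj₂ (_ , j)) () | true
    increasing (inj₁ i) (inj₂ (_ , j)) () | false
    increasing (inj₂ (b , _)) (inj₁ _) e = toℕ<n b
    increasing (inj₂ (b , j)) (inj₂ (b′ , j′)) e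
      -- Outside the pivots the closed and open out-neighbourhoods coincide, so their flips cancel.
      rewrite xor-same (sum (λ i → isSuc i j ∧ isSuc i j′)) = arc⇒< b b′ e

  length-family : length family ≡ 2 * k
  length-family = begin
    length family
      ≡⟨ length-++ (List.tabulate (fromPredicate ∘ closedOutNeighbour)) ⟩
    length (List.tabulate (fromPredicate ∘ closedOutNeighbour))
      + length (List.tabulate (fromPredicate ∘ outNeighbour))
      ≡⟨ cong₂ _+_ (length-tabulate (fromPredicate ∘ closedOutNeighbour))
                   (length-tabulate (fromPredicate ∘ outNeighbour)) ⟩
    k + k
      ≡⟨ cong (k +_) (ℕₚ.+-identityʳ k) ⟨
    2 * k ∎
    where open ≡-Reasoning

  -- The lower bound on decycling families

  module _ (Xs : List (Subset size)) (decycling : Decycling graph Xs) where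

    row : Vertex → Vector₂ (length Xs)
    row a = membership Xs (encode a)

    _⟶_ : Vertex → Vertex → Set
    a ⟶ a′ = Edge (invertAll (adj graph) Xs) (encode a) (encode a′)

    inverted : ∀ a a′ → invertAll (adj graph) Xs (encode a) (encode a′) ≡
                        (if row a · row a′ then arc a′ a else arc a a′)
    inverted a a′ = trans (invertAll-flips Xs (adj graph) (encode a) (encode a′))
      (cong₂ (if row a · row a′ then_else_) (adj-encode a′ a) (adj-encode a a′))

    -- The lower bound uses acyclicity only in this form.
    no-triangle : ∀ a b c → a ⟶ b → b ⟶ c → c ⟶ a → ⊥
    no-triangle _ _ _ e₁ e₂ e₃ = decycling _ (e₁ ∷ e₂ ∷ [ e₃ ])

    module _ (p q r : Fin B) (p<q : p <ᶠ q) (q<r : q <ᶠ r)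
             (pq : ∀ j → row (inj₂ (p , j)) ≗ row (inj₂ (q , j)))
             (pr : ∀ j → row (inj₂ (p , j)) ≗ row (inj₂ (r , j))) where

      z : Fin (suc k) → Vector₂ (length Xs)
      z j = row (inj₂ (p , j))

      y : Fin k → Vector₂ (length Xs)
      y i = row (inj₁ i)

      -- Lets the lemmas on arcs treat the blocks `p`, `q` and `r` alike, with hypotheses on the
      -- products of the `z j` only.
      Typical : Fin B → Set
      Typical b = ∀ j → z j ≗ row (inj₂ (b , j))

      pp : Typical p
      pp j t = refl

      p<r : p <ᶠ r
      p<r = <-trans p<q q<r

      kept : ∀ {b b′} → Typical b → Typical b′ → b <ᶠ b′ → ∀ {j j′} →
             z j · z j′ ≡ false → inj₂ (b , j) ⟶ inj₂ (b′ , j′)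
      kept {b} {b′} tb tb′ b<b′ {j} {j′} eq
        rewrite inverted (inj₂ (b , j)) (inj₂ (b′ , j′))
              | sym (·-cong (tb j) (tb′ j′)) | eq = dec-true (toℕ b <? toℕ b′) b<b′

      reversed : ∀ {b b′} → Typical b → Typical b′ → b <ᶠ b′ → ∀ {j j′} →
                 z j · z j′ ≡ true → inj₂ (b′ , j′) ⟶ inj₂ (b , j)
      reversed {b} {b′} tb tb′ b<b′ {j} {j′} eq
        rewrite inverted (inj₂ (b′ , j′)) (inj₂ (b , j))
              | sym (·-cong (tb′ j′) (tb j)) | ·-comm (z j′) (z j) | eq = dec-true (toℕ b <? toℕ b′) b<b′

      -- Take type `j` in the outer blocks `p` and `r`, and type `j′` in the middle block `q`. If
      -- the products differ, either the arc between `p` and `r` is kept and both arcs at `q` are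
      -- reversed, or the other way round; each case closes a directed triangle.
      gram-constant : ∀ j j′ → z j · z j′ ≡ z j · z j
      gram-constant j j′ with z j · z j in same | z j · z j′ in cross
      ... | false | false = refl
      ... | true  | true  = refl
      ... | false | true  = ⊥-elim (no-triangle (inj₂ (p , j)) (inj₂ (r , j)) (inj₂ (q , j′))
        (kept pp pr p<r {j} {j} same)
        (reversed pq pr q<r {j′} {j} (trans (·-comm (z j′) (z j)) cross))
        (reversed pp pq p<q {j} {j′} cross))
      ... | true  | false = ⊥-elim (no-triangle (inj₂ (r , j)) (inj₂ (p , j)) (inj₂ (q , j′))
        (reversed pp pr p<r {j} {j} same)
        (kept pp pq p<q {j} {j′} cross)
        (kept pq pr q<r {j′} {j} (trans (·-comm (z j′) (z j)) cross)))

      -- The direction, after the inversions, of the arc between `v i` and type `j` in a typical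
      -- block: `true` when it leaves the pivot.
      outward : Fin k → Fin (suc k) → Bool
      outward i j = isSuc i j xor y i · z j

      out : ∀ {b} → Typical b → ∀ {i j} → outward i j ≡ true → inj₁ i ⟶ inj₂ (b , j)
      out {b} tb {i} {j} eq
        rewrite inverted (inj₁ i) (inj₂ (b , j)) | sym (·-cong {x = y i} (λ _ → refl) (tb j))
        = trans (if-not (y i · z j) (isSuc i j)) eq
        where
        if-not : ∀ s t → (if s then not t else t) ≡ t xor s
        if-not false t = sym (xor-identityʳ t)
        if-not true  t = xor-comm true t

      into : ∀ {b} → Typical b → ∀ {i j} → outward i j ≡ false → inj₂ (b , j) ⟶ inj₁ i
      into {b} tb {i} {j} eq
        rewrite inverted (inj₂ (b , j)) (inj₁ i) | sym (·-cong {y = y i} (tb j) (λ _ → refl)) | ·-comm (z j) (y i)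
        = trans (if-not (y i · z j) (isSuc i j)) (cong not eq)
        where
        if-not : ∀ s t → (if s then t else not t) ≡ not (t xor s)
        if-not false false = refl
        if-not false true  = refl
        if-not true  false = refl
        if-not true  true  = refl

      -- Whether arcs between types `j` and `j′` are kept or reversed, the two can be placed in `p`
      -- and `q` so that the arc runs from `j` to `j′`, which completes a triangle through `v i`.
      outward-unmixed : ∀ i j j′ → outward i j ≡ true → outward i j′ ≡ false → ⊥
      outward-unmixed i j j′ eq eq′ with z j · z j′ in cross
      ... | false = no-triangle (inj₁ i) (inj₂ (p , j)) (inj₂ (q , j′))
        (out pp {i} {j} eq)
        (kept pp pq p<q {j} {j′} cross)
        (into pq {i} {j′} eq′)
      ... | true  = no-triangle (inj₁ i) (inj₂ (q , j)) (inj₂ (p , j′))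
        (out pq {i} {j} eq)
        (reversed pp pq p<q {j′} {j} (trans (·-comm (z j′) (z j)) cross))
        (into pp {i} {j′} eq′)

      outward-constant : ∀ i j j′ → outward i j ≡ outward i j′
      outward-constant i j j′ with outward i j in eq | outward i j′ in eq′
      ... | false | false = refl
      ... | true  | true  = refl
      ... | true  | false = ⊥-elim (outward-unmixed i j j′ eq eq′)
      ... | false | true  = ⊥-elim (outward-unmixed i j′ j eq′ eq)

      d : Fin k → Vector₂ (length Xs)
      d j = z (suc j) ⊕ z zero

      d-isotropic : ∀ i j → d i · d j ≡ false
      d-isotropic i j
        -- The expansion has four products, two with left factor `z (suc i)` and two with `z zero`;
        -- by `gram-constant` each pair cancels.
        rewrite ⊕-· (z (suc i)) (z zero) (d j)
              | ·-⊕ (z (suc i)) (z (suc j)) (z zero)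
              | ·-⊕ (z zero) (z (suc j)) (z zero)
              | gram-constant (suc i) (suc j) | gram-constant (suc i) zero | gram-constant zero (suc j)
              | xor-same (z (suc i) · z (suc i)) = xor-same (z zero · z zero)

      d-dual : ∀ i j → y i · d j ≡ does (i ≟ j)
      d-dual i j = begin
        y i · d j
          ≡⟨ ·-⊕ (y i) (z (suc j)) (z zero) ⟩
        y i · z (suc j) xor y i · z zero
          -- `outward i zero` reduces to `y i · z zero`, because `isSuc i zero` is `false`.
          ≡⟨ cong (y i · z (suc j) xor_) (outward-constant i (suc j) zero) ⟨
        y i · z (suc j) xor (does (i ≟ j) xor y i · z (suc j))
          ≡⟨ conjugate (y i · z (suc j)) (does (i ≟ j)) ⟩
        does (i ≟ j) ∎
        where
        open ≡-Reasoning
        conjugate : ∀ s t → s xor (t xor s) ≡ t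
        conjugate false t     = xor-identityʳ t
        conjugate true  false = refl
        conjugate true  true  = refl

      three-equal-blocks⇒2k≤length : 2 * k ≤ length Xs
      three-equal-blocks⇒2k≤length = isotropic-dimension y d d-isotropic d-dual

    profile : Fin B → Fin ((2 ^ length Xs) ^ suc k)
    profile b = funToFin (λ j → code (row (inj₂ (b , j))))

    profile-injective : ∀ b b′ → profile b ≡ profile b′ → ∀ j → row (inj₂ (b , j)) ≗ row (inj₂ (b′ , j))
    profile-injective b b′ eq j = code-injective _ _ (begin
      code (row (inj₂ (b , j)))    ≡⟨ finToFun-funToFin (λ j → code (row (inj₂ (b , j)))) j ⟨
      finToFun (profile b) j       ≡⟨ cong (λ s → finToFun s j) eq ⟩
      finToFun (profile b′) j      ≡⟨ finToFun-funToFin (λ j → code (row (inj₂ (b′ , j)))) j ⟩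
      code (row (inj₂ (b′ , j)))   ∎)
      where open ≡-Reasoning

theorem1p8 : ∀ (k : ℕ) → Σ ℕ (λ n → Σ (Oriented n) (λ D → InvIs D (2 * k) × TauIs D k))
theorem1p8 k =
  size , graph ,
  ((family , family-decycling , length-family) , lower) ,
  τ-graph (≤-trans (s≤s (ℕₚ.m≤m+n k colours)) (ℕₚ.m≤m*n g g))
  where
  colours g : ℕ
  -- The graph is fixed before the family is given. Only families with fewer than `2 * k` sets must
  -- be excluded, so this bounds the number of block profiles in every such case.
  colours = (2 ^ (2 * k)) ^ suc k
  -- The summand `colours` serves `pigeonhole₃`; the summand `k` ensures `k < g * g`, which provides
  -- enough blocks for the disjoint triangles.
  g = suc (k + colours)

  open Construction k (g * g)

  few : ∀ {m} → m < 2 * k → (2 ^ m) ^ suc k < g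
  few m<2k = s≤s (≤-trans (ℕₚ.^-monoˡ-≤ (suc k) (ℕₚ.^-monoʳ-≤ 2 (<⇒≤ m<2k))) (ℕₚ.m≤n+m colours k))

  lower : ∀ Xs → Decycling graph Xs → 2 * k ≤ length Xs
  lower Xs decycling with 2 * k ≤? length Xs
  ... | yes 2k≤m = 2k≤m
  ... | no  2k≰m
    with p , q , r , p<q , q<r , eq , eq′ ← pigeonhole₃ (few (≰⇒> 2k≰m)) (profile Xs decycling)
    = three-equal-blocks⇒2k≤length Xs decycling p q r p<q q<r
        (profile-injective Xs decycling p q eq) (profile-injective Xs decycling p r eq′)
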